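{- For $u,v,n\in\mathbb{N}$, let $C_3(u,v,n)$ be the number of partitions of $n$ into $u$ distinct parts congruent to $1$ modulo $3$ and $v$ distinct parts congruent to $2$ modulo $3$. Let $D_3(u,v,n)$ be the number of partitions $\lambda_1+\cdots+\lambda_s$ of $n$ into positive integers in two colours, ordinary and primed, such that only parts congruent to $\pm1\pmod 6$ may be primed, $1'$ is not a part, $u$ equals the number of ordinary parts congruent to $0$ or $1$ modulo $3$ plus twice the number of primed parts congruent to $5$ modulo $6$, $v$ equals the number of ordinary parts congruent to $0$ or $2$ modulo $3$ plus twice the number of primed parts congruent to $1$ modulo $6$, and for all $1\le i<s$: $$\lambda_i-\lambda_{i+1}\ge\begin{cases}4+\chi(\lambda_{i+1}) & \text{if }\lambda_i\equiv1,2,3,5\pmod 6\text{ and }\lambda_i\text{ is not primed},\\ 5+\chi(\lambda_{i+1}) & \text{if }\lambda_i\equiv 0,4\pmod 6,\\ 6+\chi(\lambda_{i+1}) & \text{if }\lambda_i\equiv1,5\pmod 6\text{ and }\lambda_i\text{ is primed},\end{cases}$$ where $\chi(\lambda_{i+1})=1$ if $\lambda_{i+1}$ is primed and $0$ otherwise. Then $C_3(u,v,n)=D_3(u,v,n)$ for all $u,v,n$. -}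

module Defs where

open import Data.Empty using (⊥)
open import Data.List using (List; []; _∷_; _++_; length; filter; map; cartesianProductWith)
open import Data.List.Membership.Propositional using (_∈_)
open import Data.List.Membership.Propositional.Properties using (∈-++⁺ˡ; ∈-++⁺ʳ; ∈-++⁻; ∈-filter⁺; ∈-filter⁻; ∈-cartesianProductWith⁺; ∈-cartesianProductWith⁻)
open import Data.List.Properties using (∷-injective; map-id)
open import Data.List.Relation.Unary.All as All using (All; []; _∷_)
open import Data.List.Relation.Unary.AllPairs as AllPairs using (AllPairs; []; _∷_)
open import Data.List.Relation.Unary.Any using (here; there)
open import Data.List.Relation.Unary.Linked as Linked using (Linked; linked?)
open import Data.List.Relation.Unary.Linked.Properties using (Linked⇒AllPairs)
open import Data.List.Relation.Unary.Unique.Propositional using (Unique)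
open import Data.List.Relation.Unary.Unique.Propositional.Properties using (++⁺; filter⁺; cartesianProductWith⁺)
open import Data.Nat using (ℕ; zero; suc; _+_; _*_; _≤_; _<_; _>_; _≥_; _≟_; _≤?_; _>?_; s≤s; z<s; NonZero)
open import Data.Nat.DivMod using (_%_)
open import Data.Nat.ListAction using (sum)
open import Data.Nat.Properties using (≤-trans; <-≤-trans; <-trans; <⇒≤; <-irrefl; m≤m+n; m≤n+m; m≤n⇒m≤1+n; ≤∧≢⇒<; ≤-pred; +-monoʳ-<; n≮0; +-identityʳ; ≤-reflexive)
open import Data.Product using (_×_; _,_; proj₁; proj₂)
open import Data.Sum using (_⊎_; inj₁; inj₂)
open import Function using (id; _⇔_; mk⇔)
open import Relation.Binary.PropositionalEquality using (_≡_; _≢_; refl; subst)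
open import Relation.Nullary using (Dec; yes; no; contradiction)
open import Relation.Nullary.Decidable using (map′; _×-dec_; _⊎-dec_; _→-dec_; ¬?)
open import Relation.Unary using (Pred; Decidable)
open import Level using (0ℓ)

count : {A : Set} {P : Pred A 0ℓ} → Decidable P → List A → ℕ
count P? xs = length (filter P? xs)

residue? : ∀ m r .{{_ : NonZero m}} → Decidable (λ (k : ℕ) → k % m ≡ r)
residue? m r k = k % m ≟ r

-- Partitions are lists of parts, largest part first.
record IsC₃ (u v n : ℕ) (ks : List ℕ) : Set where
  constructor mkC₃
  field
    distinct  : Linked _>_ ks
    residues  : All (λ k → k % 3 ≡ 1 ⊎ k % 3 ≡ 2) ks
    u-count   : count (residue? 3 1) ks ≡ u
    v-count   : count (residue? 3 2) ks ≡ v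
    total     : sum ks ≡ n

data Colour : Set where
  ordinary primed : Colour

record Part : Set where
  constructor part
  field
    size   : ℕ
    colour : Colour
open Part public

_≟ᶜ_ : (c d : Colour) → Dec (c ≡ d)
ordinary ≟ᶜ ordinary = yes refl
ordinary ≟ᶜ primed   = no λ ()
primed   ≟ᶜ ordinary = no λ ()
primed   ≟ᶜ primed   = yes refl

OrdinaryMod3 : ℕ → ℕ → Part → Set
OrdinaryMod3 r s p = colour p ≡ ordinary × (size p % 3 ≡ r ⊎ size p % 3 ≡ s)

ordinaryMod3? : ∀ r s → Decidable (OrdinaryMod3 r s)
ordinaryMod3? r s p = (colour p ≟ᶜ ordinary) ×-dec ((size p % 3 ≟ r) ⊎-dec (size p % 3 ≟ s))

PrimedMod6 : ℕ → Part → Set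
PrimedMod6 r p = colour p ≡ primed × size p % 6 ≡ r

primedMod6? : ∀ r → Decidable (PrimedMod6 r)
primedMod6? r p = (colour p ≟ᶜ primed) ×-dec (size p % 6 ≟ r)

Admissible : Part → Set
Admissible p = size p > 0 × (colour p ≡ primed → (size p % 6 ≡ 1 ⊎ size p % 6 ≡ 5) × size p ≢ 1)

admissible? : Decidable Admissible
admissible? p = (size p >? 0) ×-dec
  ((colour p ≟ᶜ primed) →-dec (((size p % 6 ≟ 1) ⊎-dec (size p % 6 ≟ 5)) ×-dec ¬? (size p ≟ 1)))

χ : Part → ℕ
χ (part _ ordinary) = 0
χ (part _ primed)   = 1

ordinaryGap : ℕ → ℕ
ordinaryGap 0 = 5
ordinaryGap 4 = 5
ordinaryGap _ = 4

-- The primed clause is only ever used for admissible parts, which are ±1 mod 6.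
gap : Part → ℕ
gap (part k ordinary) = ordinaryGap (k % 6)
gap (part _ primed)   = 6

-- λᵢ − λᵢ₊₁ ≥ gap λᵢ + χ λᵢ₊₁ without truncated subtraction; as gap > 0 this
-- also makes the sizes strictly decreasing.
FarApart : Part → Part → Set
FarApart p q = size p ≥ size q + (gap p + χ q)

farApart? : ∀ p q → Dec (FarApart p q)
farApart? p q = size q + (gap p + χ q) ≤? size p

record IsD₃ (u v n : ℕ) (ps : List Part) : Set where
  constructor mkD₃
  field
    admissible : All Admissible ps
    farApart   : Linked FarApart ps
    u-count    : count (ordinaryMod3? 0 1) ps + 2 * count (primedMod6? 5) ps ≡ u
    v-count    : count (ordinaryMod3? 0 2) ps + 2 * count (primedMod6? 1) ps ≡ v
    total      : sum (map size ps) ≡ n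

isC₃? : ∀ u v n → Decidable (IsC₃ u v n)
isC₃? u v n ks = map′
  (λ (a , b , c , d , e) → mkC₃ a b c d e)
  (λ (mkC₃ a b c d e) → a , b , c , d , e)
  (linked? _>?_ ks ×-dec
   All.all? (λ k → (k % 3 ≟ 1) ⊎-dec (k % 3 ≟ 2)) ks ×-dec
   (_ ≟ u) ×-dec (_ ≟ v) ×-dec (_ ≟ n))

isD₃? : ∀ u v n → Decidable (IsD₃ u v n)
isD₃? u v n ps = map′
  (λ (a , b , c , d , e) → mkD₃ a b c d e)
  (λ (mkD₃ a b c d e) → a , b , c , d , e)
  (All.all? admissible? ps ×-dec linked? farApart? ps ×-dec
   (_ ≟ u) ×-dec (_ ≟ v) ×-dec (_ ≟ n))

-- descending m lists, without repetition, the lists over A whose sizes are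
-- positive, at most m and strictly decreasing; ofSize k lists the elements of size k.
module Enumeration {A : Set} (sizeOf : A → ℕ) (ofSize : ℕ → List A)
  (ofSize-sound    : ∀ {a k} → a ∈ ofSize k → sizeOf a ≡ k)
  (ofSize-complete : ∀ a → a ∈ ofSize (sizeOf a))
  (ofSize-unique   : ∀ k → Unique (ofSize k)) where

  descending : ℕ → List (List A)
  descending zero    = [] ∷ []
  descending (suc m) = cartesianProductWith _∷_ (ofSize (suc m)) (descending m) ++ descending m

  bounded : ∀ m {xs} → xs ∈ descending m → All (λ a → sizeOf a ≤ m) xs
  bounded zero (here refl) = []
  bounded (suc m) xs∈ with ∈-++⁻ (cartesianProductWith _∷_ (ofSize (suc m)) (descending m)) xs∈
  ... | inj₂ xs∈′ = All.map m≤n⇒m≤1+n (bounded m xs∈′)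
  ... | inj₁ xs∈′ with ∈-cartesianProductWith⁻ _∷_ (ofSize (suc m)) (descending m) xs∈′
  ...   | a , as , a∈ , as∈ , refl = ≤-reflexive (ofSize-sound a∈) ∷ All.map m≤n⇒m≤1+n (bounded m as∈)

  descending-unique : ∀ m → Unique (descending m)
  descending-unique zero    = [] ∷ []
  descending-unique (suc m) = ++⁺
    (cartesianProductWith⁺ _∷_ ∷-injective (ofSize-unique (suc m)) (descending-unique m))
    (descending-unique m)
    disjoint
    where
    disjoint : ∀ {xs} → xs ∈ cartesianProductWith _∷_ (ofSize (suc m)) (descending m) × xs ∈ descending m → ⊥
    disjoint (xs∈ , xs∈′) with ∈-cartesianProductWith⁻ _∷_ (ofSize (suc m)) (descending m) xs∈
    ... | a , as , a∈ , as∈ , refl with bounded m xs∈′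
    ...   | a≤m ∷ _ = <-irrefl (ofSize-sound a∈) (s≤s a≤m)

  []∈descending : ∀ m → [] ∈ descending m
  []∈descending zero    = here refl
  []∈descending (suc m) = ∈-++⁺ʳ _ ([]∈descending m)

  descending-complete : ∀ m {xs} → AllPairs (λ a b → sizeOf a > sizeOf b) xs →
    All (λ a → sizeOf a > 0) xs → All (λ a → sizeOf a ≤ m) xs → xs ∈ descending m
  descending-complete m [] _ _ = []∈descending m
  descending-complete zero (_ ∷ _) (a>0 ∷ _) (a≤0 ∷ _) = contradiction (<-≤-trans a>0 a≤0) n≮0
  descending-complete (suc m) {a ∷ as} (a>as ∷ ds) (a>0 ∷ as>0) (a≤ ∷ _) with sizeOf a ≟ suc m
  ... | yes a≡ = ∈-++⁺ˡ (∈-cartesianProductWith⁺ _∷_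
          (subst (λ k → a ∈ ofSize k) a≡ (ofSize-complete a))
          (descending-complete m ds as>0 (All.map (λ b<a → ≤-pred (≤-trans b<a a≤)) a>as)))
  ... | no  a≢ = ∈-++⁺ʳ _ (descending-complete m (a>as ∷ ds) (a>0 ∷ as>0)
          (a≤m ∷ All.map (λ b<a → ≤-trans (<⇒≤ b<a) a≤m) a>as))
    where a≤m = ≤-pred (≤∧≢⇒< a≤ a≢)

  sizes≤sum : ∀ xs → All (λ a → sizeOf a ≤ sum (map sizeOf xs)) xs
  sizes≤sum []       = []
  sizes≤sum (a ∷ as) = m≤m+n _ _ ∷ All.map (λ b≤ → ≤-trans b≤ (m≤n+m _ (sizeOf a))) (sizes≤sum as)

plain : ℕ → List ℕ
plain k = k ∷ []

plain-sound : ∀ {j k} → j ∈ plain k → j ≡ k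
plain-sound (here refl) = refl

plain-complete : ∀ k → k ∈ plain k
plain-complete _ = here refl

plain-unique : ∀ k → Unique (plain k)
plain-unique _ = [] ∷ []

module Plain = Enumeration id plain plain-sound plain-complete plain-unique

coloured : ℕ → List Part
coloured k = part k ordinary ∷ part k primed ∷ []

coloured-sound : ∀ {p k} → p ∈ coloured k → size p ≡ k
coloured-sound (here refl)         = refl
coloured-sound (there (here refl)) = refl

coloured-complete : ∀ p → p ∈ coloured (size p)
coloured-complete (part _ ordinary) = here refl
coloured-complete (part _ primed)   = there (here refl)

coloured-unique : ∀ k → Unique (coloured k)
coloured-unique _ = ((λ ()) ∷ []) ∷ [] ∷ []

module Coloured = Enumeration size coloured coloured-sound coloured-complete coloured-unique

C₃-list : ℕ → ℕ → ℕ → List (List ℕ)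
C₃-list u v n = filter (isC₃? u v n) (Plain.descending n)

D₃-list : ℕ → ℕ → ℕ → List (List Part)
D₃-list u v n = filter (isD₃? u v n) (Coloured.descending n)

C₃ : ℕ → ℕ → ℕ → ℕ
C₃ u v n = length (C₃-list u v n)

D₃ : ℕ → ℕ → ℕ → ℕ
D₃ u v n = length (D₃-list u v n)

-- C₃ and D₃ are the cardinalities of IsC₃ u v n and IsD₃ u v n: the lists have
-- no repetitions and contain exactly the lists satisfying these predicates.

C₃-list-unique : ∀ u v n → Unique (C₃-list u v n)
C₃-list-unique u v n = filter⁺ (isC₃? u v n) (Plain.descending-unique n)

D₃-list-unique : ∀ u v n → Unique (D₃-list u v n)
D₃-list-unique u v n = filter⁺ (isD₃? u v n) (Coloured.descending-unique n)

∈-C₃-list : ∀ u v n ks → ks ∈ C₃-list u v n ⇔ IsC₃ u v n ks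
∈-C₃-list u v n ks = mk⇔
  (λ ks∈ → proj₂ (∈-filter⁻ (isC₃? u v n) {xs = Plain.descending n} ks∈))
  (λ c → ∈-filter⁺ (isC₃? u v n) (complete c) c)
  where
  pos : ∀ {k} → k % 3 ≡ 1 ⊎ k % 3 ≡ 2 → k > 0
  pos {zero}  (inj₁ ())
  pos {zero}  (inj₂ ())
  pos {suc k} _ = z<s
  complete : IsC₃ u v n ks → ks ∈ Plain.descending n
  complete (mkC₃ d r _ _ refl) = Plain.descending-complete n
    (Linked⇒AllPairs (λ j<i k<j → <-trans k<j j<i) d) (All.map pos r)
    (subst (λ js → All (_≤ sum js) ks) (map-id ks) (Plain.sizes≤sum ks))

∈-D₃-list : ∀ u v n ps → ps ∈ D₃-list u v n ⇔ IsD₃ u v n ps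
∈-D₃-list u v n ps = mk⇔
  (λ ps∈ → proj₂ (∈-filter⁻ (isD₃? u v n) {xs = Coloured.descending n} ps∈))
  (λ d → ∈-filter⁺ (isD₃? u v n) (complete d) d)
  where
  ordinaryGap>0 : ∀ r → ordinaryGap r > 0
  ordinaryGap>0 0 = z<s
  ordinaryGap>0 1 = z<s
  ordinaryGap>0 2 = z<s
  ordinaryGap>0 3 = z<s
  ordinaryGap>0 4 = z<s
  ordinaryGap>0 (suc (suc (suc (suc (suc _))))) = z<s
  gap>0 : ∀ p → gap p > 0
  gap>0 (part k ordinary) = ordinaryGap>0 (k % 6)
  gap>0 (part _ primed)   = z<s
  decreasing : ∀ {p q} → FarApart p q → size p > size q
  decreasing {p} {q} far = <-≤-trans
    (subst (_< size q + (gap p + χ q)) (+-identityʳ (size q))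
      (+-monoʳ-< (size q) (<-≤-trans (gap>0 p) (m≤m+n (gap p) (χ q)))))
    far
  complete : IsD₃ u v n ps → ps ∈ Coloured.descending n
  complete (mkD₃ a f _ _ refl) = Coloured.descending-complete n
    (Linked⇒AllPairs (λ q<p r<q → <-trans r<q q<p) (Linked.map (λ {p} {q} → decreasing {p} {q}) f))
    (All.map proj₁ a) (Coloured.sizes≤sum ps)

{-# OPTIONS --safe #-}

-- Call size p + χ p the rank of a part, so that the condition on λᵢ₊₁ given λᵢ is a bound on
-- the rank of λᵢ₊₁, and let G m be the generating polynomial, in a, b and q, of the partitions
-- of D₃ of rank at most m − 6.  Removing the part of top rank gives a linear recurrence for G
-- in each residue class modulo 6.  By induction on k these recurrences imply
--   G (7 + 6k) (a , b) = (1 + a q) G (5 + 6k) (b q , a q²).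
-- As k grows, the generating function of D₃ is fixed by F(a , b) ↦ (1 + a q) F(b q , a q²).
-- So is that of C₃, which is ∏ (1 + a q^(3i+1)) (1 + b q^(3i+2)), and this functional
-- equation determines all coefficients from those of the powers of q.

module Submission where

open import Defs
import Algebra.Solver.CommutativeMonoid
open import Data.Bool using (Bool; true; false)
open import Data.List using (List; []; _∷_; _++_; map; concatMap; filter; length; foldr)
open import Data.List.Membership.Propositional using (_∈_; find)
open import Data.List.Membership.Propositional.Properties using (∈-++⁺ˡ; ∈-++⁺ʳ; ∈-++⁻; ∈-filter⁺; ∈-filter⁻; ∈-map⁺; ∈-map⁻; ∈-concat⁺′; ∈-concat⁻′)
open import Data.List.Membership.Propositional.Properties.WithK using (unique∧set⇒bag)
open import Data.List.Properties using (map-++; map-∘; map-cong; map-concatMap; concatMap-map; concatMap-cong; filter-accept; filter-reject; filter-++; filter-none; filter-≐; length-++; ∷-injectiveʳ; ∷-injectiveˡ)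
open import Data.List.Relation.Binary.BagAndSetEquality using (∼bag⇒↭)
open import Data.List.Relation.Binary.Permutation.Propositional using (_↭_; prep; swap; ↭-refl; ↭-sym; ↭-trans; ↭-reflexive; module PermutationReasoning)
open import Data.List.Relation.Binary.Permutation.Propositional.Properties using (++⁺; ++⁺ˡ; ++⁺ʳ; ++-identityʳ; ++-commutativeMonoid; ↭-length; filter-↭) renaming (map⁺ to ↭-map⁺)
open import Data.List.Relation.Unary.All as All using (All; []; _∷_)
open import Data.List.Relation.Unary.All.Properties using (¬Any⇒All¬) renaming (map⁺ to All-map⁺)
open import Data.List.Relation.Unary.AllPairs as AllPairs using (AllPairs; []; _∷_)
open import Data.List.Relation.Unary.AllPairs.Properties using () renaming (map⁺ to AllPairs-map⁺)
open import Data.List.Relation.Unary.Any using (Any; any?; here; there)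
open import Data.List.Relation.Unary.Any.Properties using () renaming (++⁺ˡ to Any-++⁺ˡ; ++⁺ʳ to Any-++⁺ʳ)
open import Data.List.Relation.Unary.Linked as Linked using (Linked; linked?; []; [-]; _∷_)
open import Data.List.Relation.Unary.Linked.Properties using (Linked⇒AllPairs; AllPairs⇒Linked)
open import Data.List.Relation.Unary.Unique.Propositional using (Unique)
open import Data.List.Relation.Unary.Unique.Propositional.Properties using () renaming (++⁺ to Unique-++⁺; concat⁺ to Unique-concat⁺; filter⁺ to Unique-filter⁺; map⁺ to Unique-map⁺)
open import Data.Nat using (ℕ; zero; suc; _+_; _*_; _∸_; _≤_; _<_; _>_; _≟_; _≤?_; _>?_; z≤n; s≤s; z<s; s≤s⁻¹)
open import Data.Nat.DivMod using (_%_; [m+kn]%n≡m%n; m%n<n)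
open import Data.Nat.Induction using (<-rec)
open import Data.Nat.ListAction using (sum)
open import Data.Nat.Properties hiding (_≟_; _≤?_; _>?_)
open import Data.Nat.Tactic.RingSolver using (solve-∀)
open import Data.Product using (_×_; _,_; proj₁; proj₂; map₁; ∃-syntax)
open import Data.Product.Properties using (≡-dec)
open import Data.Sum using (_⊎_; inj₁; inj₂; [_,_])
open import Function using (_∘_; mk⇔; Equivalence)
open import Relation.Binary.PropositionalEquality using (_≡_; _≢_; refl; sym; trans; cong; cong₂; subst; module ≡-Reasoning)
open import Relation.Nullary using (Dec; yes; no; ¬_; does; contradiction)
open import Relation.Nullary.Decidable using (_×-dec_; _⊎-dec_; _→-dec_)
open import Relation.Unary using (Decidable)

-- Polynomials in a, b and q, and the operator `Θ`.

-- (u , v , n) stands for a ^ u * b ^ v * q ^ n.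
Monomial : Set
Monomial = ℕ × ℕ × ℕ

infixr 7 _⊕_ _·_

_⊕_ : Monomial → Monomial → Monomial
(u , v , n) ⊕ (u′ , v′ , n′) = u + u′ , v + v′ , n + n′

⊕-assoc : ∀ x y z → (x ⊕ y) ⊕ z ≡ x ⊕ (y ⊕ z)
⊕-assoc (u , v , n) (u′ , v′ , n′) (u″ , v″ , n″) =
  cong₂ _,_ (+-assoc u u′ u″) (cong₂ _,_ (+-assoc v v′ v″) (+-assoc n n′ n″))

⊕-comm : ∀ x y → x ⊕ y ≡ y ⊕ x
⊕-comm (u , v , n) (u′ , v′ , n′) =
  cong₂ _,_ (+-comm u u′) (cong₂ _,_ (+-comm v v′) (+-comm n n′))

-- A polynomial with coefficients in ℕ is the list of its monomials, up to _↭_; its sum is _++_.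
Polynomial : Set
Polynomial = List Monomial

open Algebra.Solver.CommutativeMonoid (++-commutativeMonoid {A = Monomial}) using (solve; _⊜_) renaming (_⊕_ to _⊞_)

_·_ : Monomial → Polynomial → Polynomial
x · F = map (x ⊕_) F

·-cong : ∀ x {F F′} → F ↭ F′ → x · F ↭ x · F′
·-cong x = ↭-map⁺ (x ⊕_)

·-distrib-++ : ∀ x F F′ → x · (F ++ F′) ≡ x · F ++ x · F′
·-distrib-++ x = map-++ (x ⊕_)

·-assoc : ∀ x y F → x · y · F ≡ (x ⊕ y) · F
·-assoc x y F = trans (sym (map-∘ F)) (map-cong (λ z → sym (⊕-assoc x y z)) F)

·-swap : ∀ x y F → x · y · F ≡ y · x · F
·-swap x y F = trans (·-assoc x y F) (trans (cong (_· F) (⊕-comm x y)) (sym (·-assoc y x F)))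

aq : Monomial
aq = 1 , 0 , 1

-- The substitution a ↦ b q, b ↦ a q².
σ : Monomial → Monomial
σ (u , v , n) = v , u , (u + 2 * v) + n

σ-⊕ : ∀ x y → σ (x ⊕ y) ≡ σ x ⊕ σ y
σ-⊕ (u , v , n) (u′ , v′ , n′) = cong (λ t → v + v′ , u + u′ , t) (rearrange u v n u′ v′ n′)
  where
  rearrange : ∀ u v n u′ v′ n′ →
    ((u + u′) + 2 * (v + v′)) + (n + n′) ≡ ((u + 2 * v) + n) + ((u′ + 2 * v′) + n′)
  rearrange = solve-∀

-- The operator F(a , b) ↦ (1 + a q) F(b q , a q²).
Θ : Polynomial → Polynomial
Θ F = map σ F ++ aq · map σ F

Θ-cong : ∀ {F F′} → F ↭ F′ → Θ F ↭ Θ F′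
Θ-cong F↭ = ++⁺ (↭-map⁺ σ F↭) (·-cong aq (↭-map⁺ σ F↭))

Θ-++ : ∀ F F′ → Θ (F ++ F′) ↭ Θ F ++ Θ F′
Θ-++ F F′ rewrite map-++ σ F F′ | ·-distrib-++ aq (map σ F) (map σ F′) =
  solve 4 (λ f f′ g g′ → (f ⊞ f′) ⊞ (g ⊞ g′) ⊜ (f ⊞ g) ⊞ (f′ ⊞ g′)) ↭-refl
    (map σ F) (map σ F′) (aq · map σ F) (aq · map σ F′)

Θ-· : ∀ x F → Θ (x · F) ≡ σ x · Θ F
Θ-· x F = trans (cong (λ F′ → F′ ++ aq · F′) σ-·)
  (trans (cong (σ x · map σ F ++_) (·-swap aq (σ x) (map σ F))) (sym (·-distrib-++ (σ x) (map σ F) _)))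
  where
  σ-· : map σ (x · F) ≡ σ x · map σ F
  σ-· = trans (sym (map-∘ F)) (trans (map-cong (σ-⊕ x) F) (map-∘ F))

-- Linear recurrences and their images under `Θ`.

combination : (ℕ → Polynomial) → List (Monomial × ℕ) → Polynomial
combination F = concatMap (λ (x , j) → x · F j)

-- A record instead of a bare permutation, so that `F`, `i` and the terms `ts` can be read off the
-- type.
record Recurrence (F : ℕ → Polynomial) (i : ℕ) (ts : List (Monomial × ℕ)) : Set where
  constructor recurrence
  field
    unroll : F (suc i) ↭ F i ++ combination F ts
open Recurrence

unroll₁ : ∀ {F i x j} → Recurrence F i ((x , j) ∷ []) → F (suc i) ↭ F i ++ x · F j
unroll₁ {F} {i} {x} {j} rec = ↭-trans (unroll rec) (++⁺ˡ (F i) (++-identityʳ (x · F j)))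

unroll₂ : ∀ {F i x j y l} → Recurrence F i ((x , j) ∷ (y , l) ∷ []) → F (suc i) ↭ F i ++ x · F j ++ y · F l
unroll₂ {F} {i} {x} {j} {y} {l} rec = ↭-trans (unroll rec) (++⁺ˡ (F i) (++⁺ˡ (x · F j) (++-identityʳ (y · F l))))

-- `Θ` is additive and turns a factor `x` into `σ x`, so the sequence `K` below inherits the
-- recurrences of `G` with substituted coefficients.
Θ-recurrence : ∀ {F i ts} → Recurrence F i ts → Recurrence (λ j → Θ (F j)) i (map (map₁ σ) ts)
Θ-recurrence {F} {i} {ts} rec = recurrence
  (↭-trans (Θ-cong (unroll rec)) (↭-trans (Θ-++ (F i) _) (++⁺ˡ (Θ (F i)) (Θ-combination ts))))
  where
  Θ-combination : ∀ ts → Θ (combination F ts) ↭ combination (λ j → Θ (F j)) (map (map₁ σ) ts)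
  Θ-combination [] = ↭-refl
  Θ-combination ((x , j) ∷ ts) = ↭-trans (Θ-++ (x · F j) (combination F ts))
    (++⁺ (↭-reflexive (Θ-· x (F j))) (Θ-combination ts))

-- From the gap recurrences to the functional equation of `G`.

module GapRecurrences (G : ℕ → Polynomial)
  -- The first term of each recurrence comes from an ordinary part; the second terms of `rec₂` and
  -- `rec₆` come from the primed part of size one less, which has the same rank.
  (rec₁ : ∀ k → Recurrence G (6 + k * 6) (((1 , 0 , 1 + k * 6) , 3 + k * 6) ∷ []))
  (rec₂ : ∀ k → Recurrence G (7 + k * 6) (((0 , 1 , 2 + k * 6) , 4 + k * 6) ∷ ((0 , 2 , 1 + k * 6) , 1 + k * 6) ∷ []))
  (rec₃ : ∀ k → Recurrence G (8 + k * 6) (((1 , 1 , 3 + k * 6) , 5 + k * 6) ∷ []))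
  (rec₄ : ∀ k → Recurrence G (9 + k * 6) (((1 , 0 , 4 + k * 6) , 5 + k * 6) ∷ []))
  (rec₅ : ∀ k → Recurrence G (10 + k * 6) (((0 , 1 , 5 + k * 6) , 7 + k * 6) ∷ []))
  (rec₆ : ∀ k → Recurrence G (11 + k * 6) (((1 , 1 , 6 + k * 6) , 7 + k * 6) ∷ ((2 , 0 , 5 + k * 6) , 5 + k * 6) ∷ []))
  (G₁ : G 1 ≡ []) (G₃ : G 3 ≡ (0 , 0 , 0) ∷ []) (G₄ : G 4 ≡ (0 , 0 , 0) ∷ [])
  (G₅ : G 5 ≡ (0 , 0 , 0) ∷ []) (G₆ : G 6 ≡ (0 , 0 , 0) ∷ []) where

  open PermutationReasoning

  K : ℕ → Polynomial
  K i = Θ (G i)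

  -- Only at7 is wanted in the end; at9 and at5 make it inductive.
  record Stage (k : ℕ) : Set where
    constructor stage
    field
      at7 : G (7 + k * 6) ↭ K (5 + k * 6)
      at9 : G (9 + k * 6) ↭ K (7 + k * 6)
      at5 : G (5 + k * 6) ++ aq · G (5 + k * 6) ↭ K (4 + k * 6) ++ aq · K (1 + k * 6)

  -- Everything is explicit here: `G 7` is 1 + a q, and both sides of `at9` are (1 + a q)(1 + b q²).
  stage₀ : Stage 0
  stage₀ = stage at7 at9 at5
    where
    G₇≡ : G 6 ++ (1 , 0 , 1) · G 3 ++ [] ≡ (0 , 0 , 0) ∷ (1 , 0 , 1) ∷ []
    G₇≡ rewrite G₆ | G₃ = refl
    G₇ : G 7 ↭ (0 , 0 , 0) ∷ (1 , 0 , 1) ∷ []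
    G₇ = ↭-trans (unroll (rec₁ 0)) (↭-reflexive G₇≡)
    at7 : G 7 ↭ K 5
    at7 rewrite G₅ = G₇
    at5 : G 5 ++ aq · G 5 ↭ K 4 ++ aq · K 1
    at5 rewrite G₅ | G₄ | G₁ = ↭-refl
    at9 : G 9 ↭ K 7
    at9 = begin
      G 9
        ↭⟨ unroll (rec₃ 0) ⟩
      G 8 ++ (1 , 1 , 3) · G 5 ++ []
        ↭⟨ ++⁺ʳ _ (unroll (rec₂ 0)) ⟩
      (G 7 ++ (0 , 1 , 2) · G 4 ++ (0 , 2 , 1) · G 1 ++ []) ++ (1 , 1 , 3) · G 5 ++ []
        -- `G 1` is empty, so the term of the forbidden part 1′ vanishes.
        ≡⟨ cong₂ (λ F F′ → (G 7 ++ (0 , 1 , 2) · F ++ (0 , 2 , 1) · F′ ++ []) ++ (1 , 1 , 3) · G 5 ++ []) G₄ G₁ ⟩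
      (G 7 ++ (0 , 1 , 2) ∷ []) ++ (1 , 1 , 3) · G 5 ++ []
        ≡⟨ cong (λ F → (G 7 ++ (0 , 1 , 2) ∷ []) ++ (1 , 1 , 3) · F ++ []) G₅ ⟩
      (G 7 ++ (0 , 1 , 2) ∷ []) ++ (1 , 1 , 3) ∷ []
        ↭⟨ ++⁺ʳ _ (++⁺ʳ _ G₇) ⟩
      (0 , 0 , 0) ∷ (1 , 0 , 1) ∷ (0 , 1 , 2) ∷ (1 , 1 , 3) ∷ []
        ↭⟨ prep _ (swap _ _ ↭-refl) ⟩
      Θ ((0 , 0 , 0) ∷ (1 , 0 , 1) ∷ [])
        ↭⟨ Θ-cong G₇ ⟨
      K 7 ∎

  module _ (k : ℕ) where
    private
      N = k * 6
      -- Up to a factor `aq`, these are all the coefficients that occur between `G (9 + N)` and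
      -- `G (15 + N)`, and again, two places lower, between `K (7 + N)` and `K (13 + N)`.
      x₄ x₅ x₇ x₈ y₇ : Monomial
      x₄ = 1 , 0 , 4 + N
      x₅ = 0 , 1 , 5 + N
      x₇ = 1 , 0 , 7 + N
      x₈ = 0 , 1 , 8 + N
      y₇ = 0 , 2 , 7 + N

      G₁₀ : G (10 + N) ↭ G (9 + N) ++ x₄ · G (5 + N)
      G₁₀ = unroll₁ (rec₄ k)
      G₁₁ : G (11 + N) ↭ G (10 + N) ++ x₅ · G (7 + N)
      G₁₁ = unroll₁ (rec₅ k)
      G₁₂ : G (12 + N) ↭ G (11 + N) ++ (aq ⊕ x₅) · G (7 + N) ++ (aq ⊕ x₄) · G (5 + N)
      G₁₂ = unroll₂ (rec₆ k)
      G₁₃ : G (13 + N) ↭ G (12 + N) ++ x₇ · G (9 + N)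
      G₁₃ = unroll₁ (rec₁ (suc k))
      G₁₄ : G (14 + N) ↭ G (13 + N) ++ x₈ · G (10 + N) ++ y₇ · G (7 + N)
      G₁₄ = unroll₂ (rec₂ (suc k))
      G₁₅ : G (15 + N) ↭ G (14 + N) ++ (aq ⊕ x₈) · G (11 + N)
      G₁₅ = unroll₁ (rec₃ (suc k))

      K₈ : K (8 + N) ↭ K (7 + N) ++ x₄ · K (4 + N) ++ (aq ⊕ x₄) · K (1 + N)
      K₈ = unroll₂ (Θ-recurrence (rec₂ k))
      K₉ : K (9 + N) ↭ K (8 + N) ++ (aq ⊕ x₅) · K (5 + N)
      K₉ = unroll₁ (Θ-recurrence (rec₃ k))
      K₁₀ : K (10 + N) ↭ K (9 + N) ++ x₅ · K (5 + N)
      K₁₀ = unroll₁ (Θ-recurrence (rec₄ k))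
      K₁₁ : K (11 + N) ↭ K (10 + N) ++ x₇ · K (7 + N)
      K₁₁ = unroll₁ (Θ-recurrence (rec₅ k))
      K₁₂ : K (12 + N) ↭ K (11 + N) ++ (aq ⊕ x₈) · K (7 + N) ++ y₇ · K (5 + N)
      K₁₂ = unroll₂ (Θ-recurrence (rec₆ k))
      K₁₃ : K (13 + N) ↭ K (12 + N) ++ x₈ · K (9 + N)
      K₁₃ = unroll₁ (Θ-recurrence (rec₁ (suc k)))

      -- Brings identities such as `at5` into the form met in the recurrences, where one coefficient
      -- is `aq` times the other.
      scaled-pair : ∀ x F F′ H H′ → F ++ aq · F′ ↭ H ++ aq · H′ →
        x · F ++ (aq ⊕ x) · F′ ↭ x · H ++ (aq ⊕ x) · H′
      scaled-pair x F F′ H H′ eq = begin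
        x · F ++ (aq ⊕ x) · F′  ≡⟨ expand F F′ ⟨
        x · (F ++ aq · F′)      ↭⟨ ·-cong x eq ⟩
        x · (H ++ aq · H′)      ≡⟨ expand H H′ ⟩
        x · H ++ (aq ⊕ x) · H′  ∎
        where
        expand : ∀ F F′ → x · (F ++ aq · F′) ≡ x · F ++ (aq ⊕ x) · F′
        expand F F′ = trans (·-distrib-++ x F (aq · F′))
          (cong (x · F ++_) (trans (·-swap x aq F′) (·-assoc aq x F′)))

      aq·G₁₀ : aq · G (10 + N) ↭ aq · G (9 + N) ++ (aq ⊕ x₄) · G (5 + N)
      aq·G₁₀ = begin
        aq · G (10 + N)                            ↭⟨ ·-cong aq G₁₀ ⟩
        aq · (G (9 + N) ++ x₄ · G (5 + N))         ≡⟨ ·-distrib-++ aq (G (9 + N)) _ ⟩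
        aq · G (9 + N) ++ aq · x₄ · G (5 + N)      ≡⟨ cong (aq · G (9 + N) ++_) (·-assoc aq x₄ _) ⟩
        aq · G (9 + N) ++ (aq ⊕ x₄) · G (5 + N)    ∎

      aq·G₁₁ : aq · G (11 + N) ↭ aq · G (10 + N) ++ (aq ⊕ x₅) · G (7 + N)
      aq·G₁₁ = begin
        aq · G (11 + N)                            ↭⟨ ·-cong aq G₁₁ ⟩
        aq · (G (10 + N) ++ x₅ · G (7 + N))        ≡⟨ ·-distrib-++ aq (G (10 + N)) _ ⟩
        aq · G (10 + N) ++ aq · x₅ · G (7 + N)     ≡⟨ cong (aq · G (10 + N) ++_) (·-assoc aq x₅ _) ⟩
        aq · G (10 + N) ++ (aq ⊕ x₅) · G (7 + N)   ∎

    nextStage : Stage k → Stage (suc k)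
    nextStage (stage at7 at9 at5) = stage at13 at15 at11
      where
      -- The right side is exactly what `K₈` adds to `K (7 + N)`.
      pair₄ : x₄ · G (5 + N) ++ (aq ⊕ x₄) · G (5 + N) ↭ x₄ · K (4 + N) ++ (aq ⊕ x₄) · K (1 + N)
      pair₄ = scaled-pair x₄ (G (5 + N)) (G (5 + N)) (K (4 + N)) (K (1 + N)) at5

      -- Multiplying by `aq` supplies the second copy of `G (5 + N)` that `pair₄` requires. The
      -- result serves twice: for `at11`, and multiplied by `x₈` for `at15`.
      at10-11 : G (10 + N) ++ aq · G (11 + N) ↭ K (9 + N) ++ aq · K (7 + N)
      at10-11 = begin
        G (10 + N) ++ aq · G (11 + N)
          ↭⟨ ++⁺ G₁₀ (↭-trans aq·G₁₁ (++⁺ʳ _ aq·G₁₀)) ⟩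
        (G (9 + N) ++ x₄ · G (5 + N)) ++ (aq · G (9 + N) ++ (aq ⊕ x₄) · G (5 + N)) ++ (aq ⊕ x₅) · G (7 + N)
          ↭⟨ solve 5 (λ g g′ u w z → (g ⊞ u) ⊞ ((g′ ⊞ w) ⊞ z) ⊜ g ⊞ (g′ ⊞ ((u ⊞ w) ⊞ z))) ↭-refl
               (G (9 + N)) (aq · G (9 + N)) (x₄ · G (5 + N)) ((aq ⊕ x₄) · G (5 + N)) ((aq ⊕ x₅) · G (7 + N)) ⟩
        G (9 + N) ++ aq · G (9 + N) ++ (x₄ · G (5 + N) ++ (aq ⊕ x₄) · G (5 + N)) ++ (aq ⊕ x₅) · G (7 + N)
          ↭⟨ ++⁺ at9 (++⁺ (·-cong aq at9) (++⁺ pair₄ (·-cong (aq ⊕ x₅) at7))) ⟩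
        K (7 + N) ++ aq · K (7 + N) ++ (x₄ · K (4 + N) ++ (aq ⊕ x₄) · K (1 + N)) ++ (aq ⊕ x₅) · K (5 + N)
          ↭⟨ solve 4 (λ g g′ u z → g ⊞ (g′ ⊞ (u ⊞ z)) ⊜ ((g ⊞ u) ⊞ z) ⊞ g′) ↭-refl
               (K (7 + N)) (aq · K (7 + N)) (x₄ · K (4 + N) ++ (aq ⊕ x₄) · K (1 + N)) ((aq ⊕ x₅) · K (5 + N)) ⟩
        ((K (7 + N) ++ (x₄ · K (4 + N) ++ (aq ⊕ x₄) · K (1 + N))) ++ (aq ⊕ x₅) · K (5 + N)) ++ aq · K (7 + N)
          ↭⟨ ++⁺ʳ _ (↭-trans K₉ (++⁺ʳ _ K₈)) ⟨
        K (9 + N) ++ aq · K (7 + N) ∎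

      at11 : G (11 + N) ++ aq · G (11 + N) ↭ K (10 + N) ++ aq · K (7 + N)
      at11 = begin
        G (11 + N) ++ aq · G (11 + N)
          ↭⟨ ++⁺ʳ _ G₁₁ ⟩
        (G (10 + N) ++ x₅ · G (7 + N)) ++ aq · G (11 + N)
          ↭⟨ solve 3 (λ g u g′ → (g ⊞ u) ⊞ g′ ⊜ (g ⊞ g′) ⊞ u) ↭-refl (G (10 + N)) (x₅ · G (7 + N)) (aq · G (11 + N)) ⟩
        (G (10 + N) ++ aq · G (11 + N)) ++ x₅ · G (7 + N)
          ↭⟨ ++⁺ at10-11 (·-cong x₅ at7) ⟩
        (K (9 + N) ++ aq · K (7 + N)) ++ x₅ · K (5 + N)
          ↭⟨ solve 3 (λ g u g′ → (g ⊞ u) ⊞ g′ ⊜ (g ⊞ g′) ⊞ u) ↭-refl (K (9 + N)) (aq · K (7 + N)) (x₅ · K (5 + N)) ⟩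
        (K (9 + N) ++ x₅ · K (5 + N)) ++ aq · K (7 + N)
          ↭⟨ ++⁺ʳ _ K₁₀ ⟨
        K (10 + N) ++ aq · K (7 + N) ∎

      -- The last term of `G₁₂`, due to a primed part, completes the term added in `G₁₀` to the left
      -- side of `pair₄`. The two terms in `G (7 + N)` become those of `K₉` and `K₁₀` by `at7`.
      at12 : G (12 + N) ↭ K (10 + N)
      at12 = begin
        G (12 + N)
          ↭⟨ ↭-trans G₁₂ (++⁺ʳ _ (↭-trans G₁₁ (++⁺ʳ _ G₁₀))) ⟩
        ((G (9 + N) ++ x₄ · G (5 + N)) ++ x₅ · G (7 + N)) ++ (aq ⊕ x₅) · G (7 + N) ++ (aq ⊕ x₄) · G (5 + N)
          ↭⟨ solve 5 (λ g u w w′ u′ → ((g ⊞ u) ⊞ w) ⊞ (w′ ⊞ u′) ⊜ ((g ⊞ (u ⊞ u′)) ⊞ w′) ⊞ w) ↭-refl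
               (G (9 + N)) (x₄ · G (5 + N)) (x₅ · G (7 + N)) ((aq ⊕ x₅) · G (7 + N)) ((aq ⊕ x₄) · G (5 + N)) ⟩
        ((G (9 + N) ++ (x₄ · G (5 + N) ++ (aq ⊕ x₄) · G (5 + N))) ++ (aq ⊕ x₅) · G (7 + N)) ++ x₅ · G (7 + N)
          ↭⟨ ++⁺ (++⁺ (++⁺ at9 pair₄) (·-cong (aq ⊕ x₅) at7)) (·-cong x₅ at7) ⟩
        ((K (7 + N) ++ (x₄ · K (4 + N) ++ (aq ⊕ x₄) · K (1 + N))) ++ (aq ⊕ x₅) · K (5 + N)) ++ x₅ · K (5 + N)
          ↭⟨ ↭-trans K₁₀ (++⁺ʳ _ (↭-trans K₉ (++⁺ʳ _ K₈))) ⟨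
        K (10 + N) ∎

      at13 : G (13 + N) ↭ K (11 + N)
      at13 = ↭-trans G₁₃ (↭-trans (++⁺ at12 (·-cong x₇ at9)) (↭-sym K₁₁))

      at15 : G (15 + N) ↭ K (13 + N)
      at15 = begin
        G (15 + N)
          ↭⟨ ↭-trans G₁₅ (++⁺ʳ _ G₁₄) ⟩
        (G (13 + N) ++ x₈ · G (10 + N) ++ y₇ · G (7 + N)) ++ (aq ⊕ x₈) · G (11 + N)
          ↭⟨ solve 4 (λ g u y w → (g ⊞ (u ⊞ y)) ⊞ w ⊜ (g ⊞ y) ⊞ (u ⊞ w)) ↭-refl
               (G (13 + N)) (x₈ · G (10 + N)) (y₇ · G (7 + N)) ((aq ⊕ x₈) · G (11 + N)) ⟩
        (G (13 + N) ++ y₇ · G (7 + N)) ++ (x₈ · G (10 + N) ++ (aq ⊕ x₈) · G (11 + N))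
          -- The terms with factor `x₈`, one from `G₁₄` and one from `G₁₅`, are carried over
          -- together by `at10-11`.
          ↭⟨ ++⁺ (++⁺ at13 (·-cong y₇ at7)) (scaled-pair x₈ (G (10 + N)) (G (11 + N)) (K (9 + N)) (K (7 + N)) at10-11) ⟩
        (K (11 + N) ++ y₇ · K (5 + N)) ++ (x₈ · K (9 + N) ++ (aq ⊕ x₈) · K (7 + N))
          ↭⟨ solve 4 (λ g y u w → (g ⊞ y) ⊞ (u ⊞ w) ⊜ (g ⊞ (w ⊞ y)) ⊞ u) ↭-refl
               (K (11 + N)) (y₇ · K (5 + N)) (x₈ · K (9 + N)) ((aq ⊕ x₈) · K (7 + N)) ⟩
        (K (11 + N) ++ (aq ⊕ x₈) · K (7 + N) ++ y₇ · K (5 + N)) ++ x₈ · K (9 + N)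
          ↭⟨ ↭-trans K₁₃ (++⁺ʳ _ K₁₂) ⟨
        K (13 + N) ∎

  allStages : ∀ k → Stage k
  allStages zero    = stage₀
  allStages (suc k) = nextStage k (allStages k)

  G≈ΘG : ∀ k → G (7 + k * 6) ↭ Θ (G (5 + k * 6))
  G≈ΘG k = Stage.at7 (allStages k)

-- Repetition-free lists and the weights of coloured partitions.

unique-⇔⇒↭ : ∀ {A : Set} {xs ys : List A} → Unique xs → Unique ys →
  (∀ {x} → x ∈ xs → x ∈ ys) → (∀ {x} → x ∈ ys → x ∈ xs) → xs ↭ ys
unique-⇔⇒↭ !xs !ys ⊆ ⊇ = ∼bag⇒↭ (unique∧set⇒bag !xs !ys (mk⇔ ⊆ ⊇))

indicator : Bool → ℕ
indicator false = 0
indicator true  = 1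

count-∷ : ∀ {A : Set} {P : A → Set} (P? : Decidable P) x xs →
  count P? (x ∷ xs) ≡ indicator (does (P? x)) + count P? xs
count-∷ P? x xs with does (P? x)
... | false = refl
... | true  = refl

uOf vOf : Part → ℕ
uOf p = indicator (does (ordinaryMod3? 0 1 p)) + 2 * indicator (does (primedMod6? 5 p))
vOf p = indicator (does (ordinaryMod3? 0 2 p)) + 2 * indicator (does (primedMod6? 1 p))

partWeight : Part → Monomial
partWeight p = uOf p , vOf p , size p

weight : List Part → Monomial
weight = foldr (λ p x → partWeight p ⊕ x) (0 , 0 , 0)

weight-counts : ∀ ps → weight ps ≡
  ( count (ordinaryMod3? 0 1) ps + 2 * count (primedMod6? 5) ps
  , count (ordinaryMod3? 0 2) ps + 2 * count (primedMod6? 1) ps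
  , sum (map size ps))
weight-counts []       = refl
weight-counts (p ∷ ps) rewrite weight-counts ps
  | count-∷ (ordinaryMod3? 0 1) p ps | count-∷ (primedMod6? 5) p ps
  | count-∷ (ordinaryMod3? 0 2) p ps | count-∷ (primedMod6? 1) p ps =
  cong₂ (λ u v → u , v , size p + sum (map size ps))
    (regroup (indicator (does (ordinaryMod3? 0 1 p))) (indicator (does (primedMod6? 5 p)))
      (count (ordinaryMod3? 0 1) ps) (count (primedMod6? 5) ps))
    (regroup (indicator (does (ordinaryMod3? 0 2 p))) (indicator (does (primedMod6? 1 p)))
      (count (ordinaryMod3? 0 2) ps) (count (primedMod6? 1) ps))
  where
  regroup : ∀ i j c d → (i + 2 * j) + (c + 2 * d) ≡ (i + c) + 2 * (j + d)
  regroup = solve-∀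

-- Valid coloured partitions and their reach.

Colourable : Part → Set
Colourable p = size p > 0 × (colour p ≡ primed → size p % 6 ≡ 1 ⊎ size p % 6 ≡ 5)

colourable? : Decidable Colourable
colourable? p = (size p >? 0) ×-dec ((colour p ≟ᶜ primed) →-dec ((size p % 6 ≟ 1) ⊎-dec (size p % 6 ≟ 5)))

-- The offset 6 keeps all indices of the gap recurrences in ℕ, and the value 2 at []
-- makes the gap condition below the last part exclude exactly the part 1′.
reach : List Part → ℕ
reach []      = 2
reach (p ∷ _) = 6 + (size p + χ p)

ordinaryGap-bounds : ∀ r → 4 ≤ ordinaryGap r × ordinaryGap r ≤ 5
ordinaryGap-bounds 0 = n≤1+n 4 , ≤-refl
ordinaryGap-bounds 1 = ≤-refl , n≤1+n 4
ordinaryGap-bounds 2 = ≤-refl , n≤1+n 4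
ordinaryGap-bounds 3 = ≤-refl , n≤1+n 4
ordinaryGap-bounds 4 = n≤1+n 4 , ≤-refl
ordinaryGap-bounds (suc (suc (suc (suc (suc _))))) = ≤-refl , n≤1+n 4

gap>0 : ∀ p → gap p > 0
gap>0 (part k ordinary) = ≤-trans z<s (proj₁ (ordinaryGap-bounds (k % 6)))
gap>0 (part _ primed)   = z<s

gap≤6 : ∀ p → gap p ≤ 6
gap≤6 (part k ordinary) = ≤-trans (proj₂ (ordinaryGap-bounds (k % 6))) (n≤1+n 5)
gap≤6 (part _ primed)   = ≤-refl

Valid : List Part → Set
Valid ps = All Admissible ps × Linked FarApart ps

valid? : Decidable Valid
valid? ps = All.all? admissible? ps ×-dec linked? farApart? ps

shift-gap : ∀ g s x → (6 + (s + x)) + g ≡ 6 + (s + (g + x))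
shift-gap = solve-∀

-- An ordinary part has gap at most 5 and size at least 1; a primed part has gap 6, and its size is
-- at least 2 because 1′ is forbidden.
admissible-reach : ∀ p → Admissible p → 2 + gap p ≤ 6 + size p
admissible-reach (part k ordinary) (k>0 , _) =
  ≤-trans (+-monoʳ-≤ 2 (proj₂ (ordinaryGap-bounds (k % 6)))) (+-monoʳ-≤ 6 k>0)
admissible-reach (part 0 primed) (() , _)
admissible-reach (part 1 primed) (_ , c) = contradiction refl (proj₂ (c refl))
admissible-reach (part (suc (suc k)) primed) _ = +-monoʳ-≤ 6 (s≤s (s≤s z≤n))

-- One inequality on `reach` expresses both `FarApart` and, at the last part, the ban on 1′.
-- `Colourable` omits that ban so that, positivity apart, it depends only on the residue modulo 6.
valid-uncons : ∀ {p ps} → Valid (p ∷ ps) → Colourable p × reach ps + gap p ≤ 6 + size p × Valid ps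
valid-uncons {p} {[]} (a@(s>0 , c) ∷ [] , _) = (s>0 , proj₁ ∘ c) , admissible-reach p a , [] , []
valid-uncons {p} {q ∷ _} ((s>0 , c) ∷ as , far ∷ fars) = (s>0 , proj₁ ∘ c) ,
  subst (_≤ 6 + size p) (sym (shift-gap (gap p) (size q) (χ q))) (+-monoʳ-≤ 6 far) , as , fars

valid-cons : ∀ {p ps} → Colourable p → reach ps + gap p ≤ 6 + size p → Valid ps → Valid (p ∷ ps)
valid-cons {p} {ps} (s>0 , c) far (as , fars) = (s>0 , λ c≡ → c c≡ , ≢1 p c≡ far) ∷ as , link ps far fars
  where
  reach≥2 : ∀ ps → 2 ≤ reach ps
  reach≥2 []      = ≤-refl
  reach≥2 (p ∷ _) = s≤s (s≤s z≤n)
  ≢1 : ∀ p → colour p ≡ primed → reach ps + gap p ≤ 6 + size p → size p ≢ 1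
  -- For 1′ the inequality would give 2 + 6 ≤ 7.
  ≢1 (part .1 primed) refl far refl = <-irrefl refl (≤-trans (+-monoˡ-≤ 6 (reach≥2 ps)) far)
  link : ∀ ps → reach ps + gap p ≤ 6 + size p → Linked FarApart ps → Linked FarApart (p ∷ ps)
  link []      _   _    = [-]
  link (q ∷ _) far fars =
    +-cancelˡ-≤ 6 _ _ (subst (_≤ 6 + size p) (shift-gap (gap p) (size q) (χ q)) far) ∷ fars

abstract
  -- Enumerating with sizes up to `i` loses nothing, since the reach exceeds the largest size. The
  -- definition is abstract so that these lists are not evaluated later; the small values needed are
  -- recorded below.
  validUpTo : ℕ → List (List Part)
  validUpTo i = filter (λ ps → valid? ps ×-dec (reach ps ≤? i)) (Coloured.descending i)

  validUpTo-unique : ∀ i → Unique (validUpTo i)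
  validUpTo-unique i = Unique-filter⁺ _ (Coloured.descending-unique i)

  ∈-validUpTo⁻ : ∀ {i ps} → ps ∈ validUpTo i → Valid ps × reach ps ≤ i
  ∈-validUpTo⁻ {i} ps∈ = proj₂ (∈-filter⁻ (λ ps → valid? ps ×-dec (reach ps ≤? i)) {xs = Coloured.descending i} ps∈)

  ∈-validUpTo⁺ : ∀ {i ps} → Valid ps → reach ps ≤ i → ps ∈ validUpTo i
  ∈-validUpTo⁺ {i} {ps} val@(as , fars) r≤i = ∈-filter⁺ (λ ps → valid? ps ×-dec (reach ps ≤? i))
    (Coloured.descending-complete i sorted (All.map proj₁ as) (bounded sorted r≤i)) (val , r≤i)
    where
    decreasing : ∀ {p q} → FarApart p q → size p > size q
    decreasing {p} {q} far = ≤-trans (m<m+n (size q) (≤-trans (gap>0 p) (m≤m+n (gap p) (χ q)))) far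
    sorted : AllPairs (λ p q → size p > size q) ps
    sorted = Linked⇒AllPairs (λ q<p r<q → <-trans r<q q<p) (Linked.map (λ {p} {q} → decreasing {p} {q}) fars)
    bounded : ∀ {ps} → AllPairs (λ p q → size p > size q) ps → reach ps ≤ i → All (λ p → size p ≤ i) ps
    bounded []                 _   = []
    bounded {p ∷ _} (p> ∷ _) r≤i = p≤i ∷ All.map (λ q<p → ≤-trans (<⇒≤ q<p) p≤i) p>
      where
      p≤i : size p ≤ i
      p≤i = ≤-trans (m≤m+n (size p) (χ p)) (≤-trans (m≤n+m (size p + χ p) 6) r≤i)

  -- The empty partition already reaches 2, and any other reaches at least 7.
  validUpTo-1 : validUpTo 1 ≡ []
  validUpTo-1 = refl

  validUpTo-3 : validUpTo 3 ≡ [] ∷ []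
  validUpTo-3 = refl

  validUpTo-4 : validUpTo 4 ≡ [] ∷ []
  validUpTo-4 = refl

  validUpTo-5 : validUpTo 5 ≡ [] ∷ []
  validUpTo-5 = refl

  validUpTo-6 : validUpTo 6 ≡ [] ∷ []
  validUpTo-6 = refl

-- Splitting off the part of top rank.

topParts : ℕ → List Part
-- Both candidates have rank `suc m`, since `χ` adds 1 to the primed size.
topParts m = filter colourable? (part (suc m) ordinary ∷ part m primed ∷ [])

topParts-unique : ∀ m → Unique (topParts m)
topParts-unique m = Unique-filter⁺ colourable? {part (suc m) ordinary ∷ part m primed ∷ []} (((λ ()) ∷ []) ∷ [] ∷ [])

∈-topParts⁻ : ∀ {m p} → p ∈ topParts m → Colourable p × size p + χ p ≡ suc m
∈-topParts⁻ {m} p∈ with ∈-filter⁻ colourable? {xs = part (suc m) ordinary ∷ part m primed ∷ []} p∈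
... | here refl , c         = c , +-identityʳ (suc m)
... | there (here refl) , c = c , +-comm m 1

∈-topParts⁺ : ∀ {m} p → Colourable p → size p + χ p ≡ suc m → p ∈ topParts m
∈-topParts⁺ {m} (part k ordinary) c eq with refl ← trans (sym (+-identityʳ k)) eq =
  ∈-filter⁺ colourable? {xs = part (suc m) ordinary ∷ part m primed ∷ []} (here refl) c
∈-topParts⁺ {m} (part k primed) c eq with refl ← suc-injective (trans (+-comm 1 k) eq) =
  ∈-filter⁺ colourable? {xs = part (suc m) ordinary ∷ part m primed ∷ []} (there (here refl)) c

-- The largest reach allowed for what follows `p`; no truncation occurs, as every gap is at most 6.
below : Part → ℕ
below p = 6 + size p ∸ gap p

withTop : Part → List (List Part)
withTop p = map (p ∷_) (validUpTo (below p))

-- A list of reach exactly 7 + `m` starts with a part of rank `suc m`, and its tail is any valid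
-- list whose reach the gap of that part permits.
validUpTo-step : ∀ m → validUpTo (7 + m) ↭
  validUpTo (6 + m) ++ concatMap withTop (topParts m)
validUpTo-step m = unique-⇔⇒↭ (validUpTo-unique (7 + m))
  (Unique-++⁺ (validUpTo-unique (6 + m))
    (Unique-concat⁺ (All-map⁺ (All.tabulate (λ {p} _ → Unique-map⁺ ∷-injectiveʳ (validUpTo-unique (below p)))))
             (AllPairs-map⁺ (AllPairs.map different (topParts-unique m))))
    old≢new)
  split join
  where
  different : ∀ {p q} → p ≢ q → ∀ {ps} → ¬ (ps ∈ withTop p × ps ∈ withTop q)
  different {p} {q} p≢q (ps∈ , ps∈′) with ∈-map⁻ (p ∷_) ps∈ | ∈-map⁻ (q ∷_) ps∈′
  ... | _ , _ , refl | _ , _ , eq = p≢q (∷-injectiveˡ eq)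
  new⁻ : ∀ {ps} → ps ∈ concatMap withTop (topParts m) →
    ∃[ p ] ∃[ qs ] ps ≡ p ∷ qs × p ∈ topParts m × qs ∈ validUpTo (below p)
  new⁻ ps∈ with ∈-concat⁻′ (map withTop (topParts m)) ps∈
  ... | _ , ps∈′ , pss∈ with ∈-map⁻ withTop pss∈
  ... | p , p∈ , refl with ∈-map⁻ (p ∷_) ps∈′
  ... | qs , qs∈ , refl = p , qs , refl , p∈ , qs∈
  old≢new : ∀ {ps} → ¬ (ps ∈ validUpTo (6 + m) × ps ∈ concatMap withTop (topParts m))
  old≢new (ps∈ , ps∈′) with new⁻ ps∈′
  ... | p , qs , refl , p∈ , _ = <-irrefl (cong (6 +_) (proj₂ (∈-topParts⁻ p∈)))
        (s≤s (proj₂ (∈-validUpTo⁻ {6 + m} ps∈)))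
  split : ∀ {ps} → ps ∈ validUpTo (7 + m) → ps ∈ validUpTo (6 + m) ++ concatMap withTop (topParts m)
  split {ps} ps∈ with ∈-validUpTo⁻ {7 + m} ps∈
  ... | val , r≤ with reach ps ≤? 6 + m
  ... | yes r≤′ = ∈-++⁺ˡ (∈-validUpTo⁺ val r≤′)
  split {[]} ps∈ | val , r≤ | no r≰ = contradiction (s≤s (s≤s z≤n)) r≰
  split {p ∷ qs} ps∈ | val , r≤ | no r≰ with valid-uncons val
  ... | col , far , val′ = ∈-++⁺ʳ (validUpTo (6 + m)) (∈-concat⁺′
          (∈-map⁺ (p ∷_) (∈-validUpTo⁺ val′ (m+n≤o⇒m≤o∸n (reach qs) far)))
          (∈-map⁺ withTop (∈-topParts⁺ p col (+-cancelˡ-≡ 6 _ _ (≤-antisym r≤ (≰⇒> r≰))))))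
  join : ∀ {ps} → ps ∈ validUpTo (6 + m) ++ concatMap withTop (topParts m) → ps ∈ validUpTo (7 + m)
  join ps∈ with ∈-++⁻ (validUpTo (6 + m)) ps∈
  ... | inj₁ ps∈′ with ∈-validUpTo⁻ {6 + m} ps∈′
  ...   | val , r≤ = ∈-validUpTo⁺ val (m≤n⇒m≤1+n r≤)
  join ps∈ | inj₂ ps∈′ with new⁻ ps∈′
  ...   | p , qs , refl , p∈ , qs∈ with ∈-topParts⁻ p∈ | ∈-validUpTo⁻ {below p} qs∈
  ...     | col , rank | val , r≤ = ∈-validUpTo⁺ {7 + m}
              (valid-cons col far val) (≤-reflexive (cong (6 +_) rank))
    where
    far : reach qs + gap p ≤ 6 + size p
    far = m≤o∸n⇒m+n≤o (reach qs) (≤-trans (gap≤6 p) (m≤m+n 6 (size p))) r≤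

-- The recurrences of `G` in each residue class modulo 6.

G : ℕ → Polynomial
G i = map weight (validUpTo i)

term : Part → Monomial × ℕ
term p = partWeight p , below p

G-recurrence : ∀ m → Recurrence G (6 + m) (map term (topParts m))
G-recurrence m = recurrence (↭-trans (↭-map⁺ weight (validUpTo-step m)) (↭-reflexive
  (trans (map-++ weight (validUpTo (6 + m)) _) (cong (G (6 + m) ++_) new))))
  where
  new : map weight (concatMap withTop (topParts m)) ≡ combination G (map term (topParts m))
  new = trans (map-concatMap weight withTop (topParts m))
    (trans (concatMap-cong (λ p → trans (sym (map-∘ (validUpTo (below p)))) (map-∘ (validUpTo (below p)))) (topParts m))
           (sym (concatMap-map _ term (topParts m))))

mod3-periodic : ∀ r k → (r + k * 6) % 3 ≡ r % 3
mod3-periodic r k = trans (cong (λ N → (r + N) % 3) (sym (*-assoc k 2 3))) ([m+kn]%n≡m%n r (k * 2) 3)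

mod6-periodic : ∀ r k → (r + k * 6) % 6 ≡ r % 6
mod6-periodic r k = [m+kn]%n≡m%n r k 6

periodicTerm : Colour → ℕ → ℕ → Monomial × ℕ
periodicTerm c r k = (uOf (part r c) , vOf (part r c) , r + k * 6) , 6 + (r + k * 6) ∸ gap (part r c)

-- Gaps and counts see the size only through its residues modulo 3 and 6, so `k` survives only in
-- the exponent of q and in the index. For a literal `r` the right side evaluates to a term of
-- `GapRecurrences`.
term-periodic : ∀ c r k → term (part (r + k * 6) c) ≡ periodicTerm c r k
term-periodic ordinary r k = cong₂
  (λ t s → ((indicator (does ((t ≟ 0) ⊎-dec (t ≟ 1))) + 0 , indicator (does ((t ≟ 0) ⊎-dec (t ≟ 2))) + 0 , r + k * 6)
           , 6 + (r + k * 6) ∸ ordinaryGap s))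
  (mod3-periodic r k) (mod6-periodic r k)
term-periodic primed r k = cong
  (λ s → ((2 * indicator (does (s ≟ 5)) , 2 * indicator (does (s ≟ 1)) , r + k * 6) , r + k * 6))
  (mod6-periodic r k)

topParts-ordinary : ∀ m → topParts m ≡ part (suc m) ordinary ∷ filter colourable? (part m primed ∷ [])
topParts-ordinary m = filter-accept colourable? {xs = part m primed ∷ []} (z<s , λ ())

-- The primed candidate has size `r + k * 6`, one less than the ordinary one, so the residue of `r`
-- decides whether it occurs.
G-recurrence₁ : ∀ r k → ¬ (r % 6 ≡ 1 ⊎ r % 6 ≡ 5) →
  Recurrence G (6 + (r + k * 6)) (periodicTerm ordinary (suc r) k ∷ [])
G-recurrence₁ r k ¬c = subst (Recurrence G _) terms (G-recurrence (r + k * 6))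
  where
  no-primed : filter colourable? (part (r + k * 6) primed ∷ []) ≡ []
  no-primed = filter-reject colourable? {x = part (r + k * 6) primed} {xs = []}
    (λ (_ , c) → ¬c (subst (λ s → s ≡ 1 ⊎ s ≡ 5) (mod6-periodic r k) (c refl)))
  terms : map term (topParts (r + k * 6)) ≡ periodicTerm ordinary (suc r) k ∷ []
  terms = trans (cong (map term) (trans (topParts-ordinary (r + k * 6)) (cong (part (suc r + k * 6) ordinary ∷_) no-primed)))
    (cong (_∷ []) (term-periodic ordinary (suc r) k))

G-recurrence₂ : ∀ r k → r > 0 → r % 6 ≡ 1 ⊎ r % 6 ≡ 5 →
  Recurrence G (6 + (r + k * 6)) (periodicTerm ordinary (suc r) k ∷ periodicTerm primed r k ∷ [])
G-recurrence₂ r k r>0 c = subst (Recurrence G _) terms (G-recurrence (r + k * 6))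
  where
  one-primed : filter colourable? (part (r + k * 6) primed ∷ []) ≡ part (r + k * 6) primed ∷ []
  one-primed = filter-accept colourable? {x = part (r + k * 6) primed} {xs = []}
    (≤-trans r>0 (m≤m+n r (k * 6)) , λ _ → subst (λ s → s ≡ 1 ⊎ s ≡ 5) (sym (mod6-periodic r k)) c)
  terms : map term (topParts (r + k * 6)) ≡ periodicTerm ordinary (suc r) k ∷ periodicTerm primed r k ∷ []
  terms = trans (cong (map term) (trans (topParts-ordinary (r + k * 6)) (cong (part (suc r + k * 6) ordinary ∷_) one-primed)))
    (cong₂ (λ t t′ → t ∷ t′ ∷ []) (term-periodic ordinary (suc r) k) (term-periodic primed r k))

open GapRecurrences G
  (λ k → G-recurrence₁ 0 k [ (λ ()) , (λ ()) ])
  (λ k → G-recurrence₂ 1 k z<s (inj₁ refl))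
  (λ k → G-recurrence₁ 2 k [ (λ ()) , (λ ()) ])
  (λ k → G-recurrence₁ 3 k [ (λ ()) , (λ ()) ])
  (λ k → G-recurrence₁ 4 k [ (λ ()) , (λ ()) ])
  (λ k → G-recurrence₂ 5 k z<s (inj₂ refl))
  (cong (map weight) validUpTo-1) (cong (map weight) validUpTo-3) (cong (map weight) validUpTo-4)
  (cong (map weight) validUpTo-5) (cong (map weight) validUpTo-6)
  using (G≈ΘG)

-- Coefficients of polynomials, and `D₃` as a coefficient of `G`.

_≟ᵐ_ : (x y : Monomial) → Dec (x ≡ y)
_≟ᵐ_ = ≡-dec _≟_ (≡-dec _≟_ _≟_)

coefficient : Monomial → Polynomial → ℕ
coefficient x = count (x ≟ᵐ_)

coefficient-↭ : ∀ x {F F′} → F ↭ F′ → coefficient x F ≡ coefficient x F′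
coefficient-↭ x F↭ = ↭-length (filter-↭ (x ≟ᵐ_) F↭)

coefficient-++ : ∀ x F F′ → coefficient x (F ++ F′) ≡ coefficient x F + coefficient x F′
coefficient-++ x F F′ = trans (cong length (filter-++ (x ≟ᵐ_) F F′)) (length-++ (filter (x ≟ᵐ_) F))

count-map : ∀ {A B : Set} {P : B → Set} (P? : Decidable P) (f : A → B) xs →
  count P? (map f xs) ≡ count (λ x → P? (f x)) xs
count-map P? f []       = refl
count-map P? f (x ∷ xs) with does (P? (f x))
... | false = count-map P? f xs
... | true  = cong suc (count-map P? f xs)

module _ {f : Monomial → Monomial} (f-injective : ∀ {y z} → f y ≡ f z → y ≡ z) where

  coefficient-map : ∀ y F → coefficient (f y) (map f F) ≡ coefficient y F
  coefficient-map y F = trans (count-map (f y ≟ᵐ_) f F)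
    (cong length (filter-≐ (λ z → f y ≟ᵐ f z) (y ≟ᵐ_) (f-injective , cong f) F))

  -- By injectivity `x` has at most one preimage. It is searched for among the monomials present; if
  -- none is found, both coefficients vanish.
  coefficient-map-cong : ∀ x F F′ → (∀ y → f y ≡ x → coefficient y F ≡ coefficient y F′) →
    coefficient x (map f F) ≡ coefficient x (map f F′)
  coefficient-map-cong x F F′ eq with any? (λ y → f y ≟ᵐ x) (F ++ F′)
  ... | yes found with find found
  ...   | y , _ , refl = trans (coefficient-map y F) (trans (eq y refl) (sym (coefficient-map y F′)))
  coefficient-map-cong x F F′ eq | no none = trans (absent F (none ∘ Any-++⁺ˡ)) (sym (absent F′ (none ∘ Any-++⁺ʳ F)))
    where
    absent : ∀ F → ¬ Any (λ y → f y ≡ x) F → coefficient x (map f F) ≡ 0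
    absent F none = trans (count-map (x ≟ᵐ_) f F)
      (cong length (filter-none (λ y → x ≟ᵐ f y) (All.map (_∘ sym) (¬Any⇒All¬ F none))))

aq⊕-injective : ∀ {y z} → aq ⊕ y ≡ aq ⊕ z → y ≡ z
aq⊕-injective refl = refl

σ-injective : ∀ {y z} → σ y ≡ σ z → y ≡ z
σ-injective {u , v , n} {u′ , v′ , n′} eq with cong proj₁ eq | cong (proj₁ ∘ proj₂) eq
... | refl | refl = cong (λ t → u , v , t) (+-cancelˡ-≡ (u + 2 * v) n n′ (cong (proj₂ ∘ proj₂) eq))

coefficient-Θ-cong : ∀ x F F′ →
  (∀ y → σ y ≡ x → coefficient y F ≡ coefficient y F′) →
  (∀ y → aq ⊕ σ y ≡ x → coefficient y F ≡ coefficient y F′) →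
  coefficient x (Θ F) ≡ coefficient x (Θ F′)
coefficient-Θ-cong x F F′ eq eq′ = begin
  coefficient x (Θ F)
    ≡⟨ coefficient-++ x (map σ F) _ ⟩
  coefficient x (map σ F) + coefficient x (aq · map σ F)
    ≡⟨ cong₂ _+_ (coefficient-map-cong σ-injective x F F′ eq)
         (coefficient-map-cong aq⊕-injective x (map σ F) (map σ F′)
           (λ z z↦x → coefficient-map-cong σ-injective z F F′ (λ y y↦z → eq′ y (trans (cong (aq ⊕_) y↦z) z↦x)))) ⟩
  coefficient x (map σ F′) + coefficient x (aq · map σ F′)
    ≡⟨ coefficient-++ x (map σ F′) _ ⟨
  coefficient x (Θ F′) ∎
  where open ≡-Reasoning

-- The top rank of a partition of `n` is at most `n` + 1, so the bound on the reach excludes nothing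
-- once `i` is at least `n + 7`.
D₃-coefficient : ∀ u v n i → n + 7 ≤ i → D₃ u v n ≡ coefficient (u , v , n) (G i)
D₃-coefficient u v n i n≤i = trans (↭-length D₃-list↭) (sym (count-map ((u , v , n) ≟ᵐ_) weight (validUpTo i)))
  where
  P? : Decidable (λ ps → (u , v , n) ≡ weight ps)
  P? ps = (u , v , n) ≟ᵐ weight ps
  reach≤ : ∀ ps → reach ps ≤ sum (map size ps) + 7
  reach≤ []       = s≤s (s≤s z≤n)
  reach≤ (p ∷ ps) = subst (_≤ (size p + sum (map size ps)) + 7) (+-comm (size p + χ p) 6)
    (subst (_≤ (size p + sum (map size ps)) + 7) (sym (+-assoc (size p) (χ p) 6))
      (+-mono-≤ (m≤m+n (size p) (sum (map size ps))) (+-monoˡ-≤ 6 (χ≤1 p))))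
    where
    χ≤1 : ∀ p → χ p ≤ 1
    χ≤1 (part _ ordinary) = z≤n
    χ≤1 (part _ primed)   = ≤-refl
  to : ∀ {ps} → ps ∈ D₃-list u v n → ps ∈ filter P? (validUpTo i)
  to {ps} ps∈ with Equivalence.to (∈-D₃-list u v n ps) ps∈
  ... | mkD₃ as fars refl refl refl = ∈-filter⁺ P?
          (∈-validUpTo⁺ (as , fars) (≤-trans (reach≤ ps) n≤i)) (sym (weight-counts ps))
  from : ∀ {ps} → ps ∈ filter P? (validUpTo i) → ps ∈ D₃-list u v n
  from {ps} ps∈ with ∈-filter⁻ P? {xs = validUpTo i} ps∈
  ... | ps∈′ , eq with ∈-validUpTo⁻ {i} ps∈′ | trans eq (weight-counts ps)
  ...   | (as , fars) , _ | refl = Equivalence.from (∈-D₃-list u v n ps) (mkD₃ as fars refl refl refl)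
  D₃-list↭ : D₃-list u v n ↭ filter P? (validUpTo i)
  D₃-list↭ = unique-⇔⇒↭ (D₃-list-unique u v n) (Unique-filter⁺ P? (validUpTo-unique i)) to from

-- Parts not divisible by 3, and the product for `C₃`.

nonMultiple : ℕ → ℕ
nonMultiple 0             = 1
nonMultiple 1             = 2
-- Two indices make one period of 3, giving the sequence 1, 2, 4, 5, 7, 8, and so on.
nonMultiple (suc (suc j)) = 3 + nonMultiple j

NonMultiple : ℕ → Set
NonMultiple k = k % 3 ≡ 1 ⊎ k % 3 ≡ 2

nonMultiple-sound : ∀ j → NonMultiple (nonMultiple j)
nonMultiple-sound 0             = inj₁ refl
nonMultiple-sound 1             = inj₂ refl
nonMultiple-sound (suc (suc j)) = nonMultiple-sound j

nonMultiple-< : ∀ j → nonMultiple j < nonMultiple (suc j)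
nonMultiple-< 0             = ≤-refl
nonMultiple-< 1             = n≤1+n 3
nonMultiple-< (suc (suc j)) = +-monoʳ-< 3 (nonMultiple-< j)

j<nonMultiple : ∀ j → j < nonMultiple j
j<nonMultiple 0       = ≤-refl
j<nonMultiple (suc j) = ≤-<-trans (j<nonMultiple j) (nonMultiple-< j)

-- Between consecutive terms lies nothing or a single multiple of 3; moving two indices shifts the
-- situation by 3.
nonMultiple-next : ∀ j {k} → NonMultiple k → k < nonMultiple (suc j) → k ≤ nonMultiple j
nonMultiple-next 0             _  k<         = s≤s⁻¹ k<
nonMultiple-next 1 {0}         _  _          = z≤n
nonMultiple-next 1 {1}         _  _          = s≤s z≤n
nonMultiple-next 1 {2}         _  _          = ≤-refl
nonMultiple-next 1 {3}         (inj₁ ()) _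
nonMultiple-next 1 {3}         (inj₂ ()) _
nonMultiple-next 1 {suc (suc (suc (suc _)))} _ (s≤s (s≤s (s≤s (s≤s ()))))
nonMultiple-next (suc (suc j)) {0} _ _       = z≤n
nonMultiple-next (suc (suc j)) {1} _ _       = s≤s z≤n
nonMultiple-next (suc (suc j)) {2} _ _       = s≤s (s≤s z≤n)
nonMultiple-next (suc (suc j)) {suc (suc (suc k))} nm k< =
  +-monoʳ-≤ 3 (nonMultiple-next j {k} nm (+-cancelˡ-< 3 _ _ k<))

distinctBelow : ℕ → List (List ℕ)
distinctBelow 0       = [] ∷ []
distinctBelow (suc j) = distinctBelow j ++ map (nonMultiple j ∷_) (distinctBelow j)

∈-distinctBelow⁻ : ∀ j {ks} → ks ∈ distinctBelow j →
  AllPairs _>_ ks × All NonMultiple ks × All (_< nonMultiple j) ks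
∈-distinctBelow⁻ 0 (here refl) = [] , [] , []
∈-distinctBelow⁻ (suc j) ks∈ with ∈-++⁻ (distinctBelow j) ks∈
... | inj₁ ks∈′ with ∈-distinctBelow⁻ j ks∈′
...   | d , r , b = d , r , All.map (λ k< → <-trans k< (nonMultiple-< j)) b
∈-distinctBelow⁻ (suc j) ks∈ | inj₂ ks∈′ with ∈-map⁻ (nonMultiple j ∷_) ks∈′
...   | js , js∈ , refl with ∈-distinctBelow⁻ j js∈
...     | d , r , b = b ∷ d , nonMultiple-sound j ∷ r ,
            nonMultiple-< j ∷ All.map (λ k< → <-trans k< (nonMultiple-< j)) b

∈-distinctBelow⁺ : ∀ j {ks} → AllPairs _>_ ks → All NonMultiple ks → All (_< nonMultiple j) ks → ks ∈ distinctBelow j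
∈-distinctBelow⁺ 0 {[]} _ _ _ = here refl
∈-distinctBelow⁺ 0 {0 ∷ _} _ (inj₁ () ∷ _) _
∈-distinctBelow⁺ 0 {0 ∷ _} _ (inj₂ () ∷ _) _
∈-distinctBelow⁺ 0 {suc _ ∷ _} _ _ (s≤s () ∷ _)
∈-distinctBelow⁺ (suc j) {[]} d r b = ∈-++⁺ˡ (∈-distinctBelow⁺ j [] [] [])
∈-distinctBelow⁺ (suc j) {k ∷ ks} (k> ∷ d) (nm ∷ r) (k< ∷ b) with k ≟ nonMultiple j
... | yes refl = ∈-++⁺ʳ (distinctBelow j) (∈-map⁺ (k ∷_) (∈-distinctBelow⁺ j d r k>))
... | no  k≢   = ∈-++⁺ˡ (∈-distinctBelow⁺ j (k> ∷ d) (nm ∷ r) (k<′ ∷ All.map (λ l<k → <-trans l<k k<′) k>))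
  where
  k<′ : k < nonMultiple j
  k<′ = ≤∧≢⇒< (nonMultiple-next j nm k<) k≢

distinctBelow-unique : ∀ j → Unique (distinctBelow j)
distinctBelow-unique 0       = [] ∷ []
distinctBelow-unique (suc j) = Unique-++⁺ (distinctBelow-unique j) (Unique-map⁺ ∷-injectiveʳ (distinctBelow-unique j)) disjoint
  where
  disjoint : ∀ {ks} → ¬ (ks ∈ distinctBelow j × ks ∈ map (nonMultiple j ∷_) (distinctBelow j))
  disjoint (ks∈ , ks∈′) with ∈-map⁻ (nonMultiple j ∷_) ks∈′
  ... | _ , _ , refl with ∈-distinctBelow⁻ j ks∈
  ...   | _ , _ , j<j ∷ _ = <-irrefl refl j<j

plainWeight : ℕ → Monomial
plainWeight k = indicator (does (residue? 3 1 k)) , indicator (does (residue? 3 2 k)) , k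

weightᶜ : List ℕ → Monomial
weightᶜ = foldr (λ k x → plainWeight k ⊕ x) (0 , 0 , 0)

weightᶜ-counts : ∀ ks → weightᶜ ks ≡ (count (residue? 3 1) ks , count (residue? 3 2) ks , sum ks)
weightᶜ-counts []       = refl
weightᶜ-counts (k ∷ ks) rewrite weightᶜ-counts ks | count-∷ (residue? 3 1) k ks | count-∷ (residue? 3 2) k ks = refl

-- The product of the first `j` factors among 1 + a q, 1 + b q², 1 + a q⁴, 1 + b q⁵, and so on.
P : ℕ → Polynomial
P j = map weightᶜ (distinctBelow j)

P-suc : ∀ j → P (suc j) ≡ P j ++ plainWeight (nonMultiple j) · P j
P-suc j = trans (map-++ weightᶜ (distinctBelow j) _)
  (cong (P j ++_) (trans (sym (map-∘ (distinctBelow j))) (map-∘ (distinctBelow j))))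

-- The substitution sends a q^(3i+1) to b q^(3i+2) and b q^(3i+2) to a q^(3i+4).
σ-plainWeight : ∀ j → σ (plainWeight (nonMultiple j)) ≡ plainWeight (nonMultiple (suc j))
σ-plainWeight 0             = refl
σ-plainWeight 1             = refl
σ-plainWeight (suc (suc j)) = trans (σ-q³ (plainWeight (nonMultiple j))) (cong ((0 , 0 , 3) ⊕_) (σ-plainWeight j))
  where
  σ-q³ : ∀ x → σ ((0 , 0 , 3) ⊕ x) ≡ (0 , 0 , 3) ⊕ σ x
  σ-q³ = σ-⊕ (0 , 0 , 3)

-- `σ` moves each factor of the product to the next one, and the factor 1 + a q of `Θ` fills the
-- vacant first place.
P≈ΘP : ∀ j → P (suc j) ↭ Θ (P j)
P≈ΘP 0       = ↭-refl
P≈ΘP (suc j) = begin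
  P (suc (suc j))
    ≡⟨ P-suc (suc j) ⟩
  P (suc j) ++ plainWeight (nonMultiple (suc j)) · P (suc j)
    ↭⟨ ++⁺ (P≈ΘP j) (·-cong (plainWeight (nonMultiple (suc j))) (P≈ΘP j)) ⟩
  Θ (P j) ++ plainWeight (nonMultiple (suc j)) · Θ (P j)
    ≡⟨ cong (λ x → Θ (P j) ++ x · Θ (P j)) (σ-plainWeight j) ⟨
  Θ (P j) ++ σ (plainWeight (nonMultiple j)) · Θ (P j)
    ≡⟨ cong (Θ (P j) ++_) (Θ-· (plainWeight (nonMultiple j)) (P j)) ⟨
  Θ (P j) ++ Θ (plainWeight (nonMultiple j) · P j)
    ↭⟨ Θ-++ (P j) _ ⟨
  Θ (P j ++ plainWeight (nonMultiple j) · P j)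
    ≡⟨ cong Θ (P-suc j) ⟨
  Θ (P (suc j)) ∎
  where open PermutationReasoning

-- Parts of a partition of `n` are at most `j`, hence below `nonMultiple j`.
C₃-coefficient : ∀ u v n j → n ≤ j → C₃ u v n ≡ coefficient (u , v , n) (P j)
C₃-coefficient u v n j n≤j = trans (↭-length C₃-list↭) (sym (count-map ((u , v , n) ≟ᵐ_) weightᶜ (distinctBelow j)))
  where
  P? : Decidable (λ ks → (u , v , n) ≡ weightᶜ ks)
  P? ks = (u , v , n) ≟ᵐ weightᶜ ks
  parts≤sum : ∀ ks → All (_≤ sum ks) ks
  parts≤sum []       = []
  parts≤sum (k ∷ ks) = m≤m+n k (sum ks) ∷ All.map (λ l≤ → ≤-trans l≤ (m≤n+m (sum ks) k)) (parts≤sum ks)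
  to : ∀ {ks} → ks ∈ C₃-list u v n → ks ∈ filter P? (distinctBelow j)
  to {ks} ks∈ with Equivalence.to (∈-C₃-list u v n ks) ks∈
  ... | mkC₃ d r refl refl refl = ∈-filter⁺ P?
          (∈-distinctBelow⁺ j (Linked⇒AllPairs (λ l<k m<l → <-trans m<l l<k) d) r
            (All.map (λ k≤ → ≤-<-trans (≤-trans k≤ n≤j) (j<nonMultiple j)) (parts≤sum ks)))
          (sym (weightᶜ-counts ks))
  from : ∀ {ks} → ks ∈ filter P? (distinctBelow j) → ks ∈ C₃-list u v n
  from {ks} ks∈ with ∈-filter⁻ P? {xs = distinctBelow j} ks∈
  ... | ks∈′ , eq with ∈-distinctBelow⁻ j ks∈′ | trans eq (weightᶜ-counts ks)
  ...   | d , r , _ | refl = Equivalence.from (∈-C₃-list u v n ks) (mkC₃ (AllPairs⇒Linked d) r refl refl refl)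
  C₃-list↭ : C₃-list u v n ↭ filter P? (distinctBelow j)
  C₃-list↭ = unique-⇔⇒↭ (C₃-list-unique u v n) (Unique-filter⁺ P? (distinctBelow-unique j)) to from

-- The coefficients of the powers of q.

length-none : ∀ {A : Set} (xs : List A) → (∀ {x} → ¬ x ∈ xs) → length xs ≡ 0
length-none []      _    = refl
length-none (x ∷ _) none = contradiction (here refl) none

C₃-weightless : ∀ n → C₃ 0 0 (suc n) ≡ 0
C₃-weightless n = length-none (C₃-list 0 0 (suc n))
  (λ {ks} ks∈ → impossible ks (Equivalence.to (∈-C₃-list 0 0 (suc n) ks) ks∈))
  where
  weighs : ∀ k → NonMultiple k → proj₁ (plainWeight k) ≡ 0 → proj₁ (proj₂ (plainWeight k)) ≢ 0
  weighs k (inj₁ e) u≡0 _ rewrite e = contradiction u≡0 λ ()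
  weighs k (inj₂ e) _ v≡0 rewrite e = contradiction v≡0 λ ()
  impossible : ∀ ks → ¬ IsC₃ 0 0 (suc n) ks
  impossible [] c = contradiction (IsC₃.total c) λ ()
  impossible (k ∷ ks) (mkC₃ _ (nm ∷ _) u≡ v≡ _) = weighs k nm
    (m+n≡0⇒m≡0 _ (trans (sym (count-∷ (residue? 3 1) k ks)) u≡))
    (m+n≡0⇒m≡0 _ (trans (sym (count-∷ (residue? 3 2) k ks)) v≡))

-- Every ordinary part counts towards u or v whatever its residue modulo 3, and every primed part
-- counts twice towards one of them.
D₃-weightless : ∀ n → D₃ 0 0 (suc n) ≡ 0
D₃-weightless n = length-none (D₃-list 0 0 (suc n))
  (λ {ps} ps∈ → impossible ps (Equivalence.to (∈-D₃-list 0 0 (suc n) ps) ps∈))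
  where
  weighs : ∀ p → Admissible p → uOf p ≡ 0 → vOf p ≢ 0
  weighs (part k ordinary) _ u≡0 v≡0 with k % 3 | m%n<n k 3
  ... | 0 | _ = contradiction u≡0 λ ()
  ... | 1 | _ = contradiction u≡0 λ ()
  ... | 2 | _ = contradiction v≡0 λ ()
  ... | suc (suc (suc _)) | s≤s (s≤s (s≤s ()))
  weighs (part k primed) (_ , c) u≡0 v≡0 with proj₁ (c refl)
  ... | inj₁ e rewrite e = contradiction v≡0 λ ()
  ... | inj₂ e rewrite e = contradiction u≡0 λ ()
  impossible : ∀ ps → ¬ IsD₃ 0 0 (suc n) ps
  impossible [] d = contradiction (IsD₃.total d) λ ()
  impossible (p ∷ ps) (mkD₃ (a ∷ _) _ u≡ v≡ _) = weighs p a
    (m+n≡0⇒m≡0 (uOf p) (trans (cong proj₁ (weight-counts (p ∷ ps))) u≡))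
    (m+n≡0⇒m≡0 (vOf p) (trans (cong (proj₁ ∘ proj₂) (weight-counts (p ∷ ps))) v≡))

-- `σ` fixes the powers of q, so the functional equation says nothing about these coefficients and
-- they are compared directly.
weightless : ∀ n → C₃ 0 0 n ≡ D₃ 0 0 n
weightless zero    = refl
weightless (suc n) = trans (C₃-weightless n) (sym (D₃-weightless n))

-- Comparison of coefficients by induction on the exponent of q.

theorem2p4 : ∀ (u v n : ℕ) → C₃ u v n ≡ D₃ u v n
theorem2p4 u v n = <-rec (λ n → ∀ u v → C₃ u v n ≡ D₃ u v n) step n u v
  where
  step : ∀ n → (∀ {m} → m < n → ∀ u v → C₃ u v m ≡ D₃ u v m) → ∀ u v → C₃ u v n ≡ D₃ u v n
  step n ih u v = begin
    C₃ u v n                            ≡⟨ C₃-coefficient u v n (suc n) (n≤1+n n) ⟩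
    coefficient x (P (suc n))           ≡⟨ coefficient-↭ x (P≈ΘP n) ⟩
    coefficient x (Θ (P n))             ≡⟨ coefficient-Θ-cong x (P n) (G (5 + i)) via-σ via-aqσ ⟩
    coefficient x (Θ (G (5 + i)))       ≡⟨ coefficient-↭ x (G≈ΘG (suc n)) ⟨
    coefficient x (G (7 + i))           ≡⟨ D₃-coefficient u v n (7 + i) (≤-trans n+7≤ (m≤n+m (5 + i) 2)) ⟨
    D₃ u v n                            ∎
    where
    open ≡-Reasoning
    x = u , v , n
    -- With `suc n` periods both indices 5 + `i` and 7 + `i` are at least `n + 7`, as
    -- `D₃-coefficient` demands.
    i = suc n * 6
    n+7≤ : n + 7 ≤ 5 + i
    n+7≤ = subst (_≤ 5 + i) (+-comm 7 n) (+-mono-≤ (m≤m+n 7 4) (m≤m*n n 6))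
    transport : ∀ u′ v′ n′ → n′ ≤ n → C₃ u′ v′ n′ ≡ D₃ u′ v′ n′ →
      coefficient (u′ , v′ , n′) (P n) ≡ coefficient (u′ , v′ , n′) (G (5 + i))
    transport u′ v′ n′ n′≤n eq = trans (sym (C₃-coefficient u′ v′ n′ n n′≤n))
      (trans eq (D₃-coefficient u′ v′ n′ (5 + i) (≤-trans (+-monoˡ-≤ 7 n′≤n) n+7≤)))
    -- σ raises the exponent of q except on the powers of q.
    via-σ : ∀ y → σ y ≡ x → coefficient y (P n) ≡ coefficient y (G (5 + i))
    via-σ (zero , zero , _)    refl = transport 0 0 n ≤-refl (weightless n)
    via-σ (zero , suc v′ , n′) refl = transport 0 (suc v′) n′ (m≤n+m n′ _) (ih (s≤s (m≤n+m n′ _)) 0 (suc v′))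
    via-σ (suc u′ , v′ , n′)   refl = transport (suc u′) v′ n′ (m≤n+m n′ _) (ih (s≤s (m≤n+m n′ _)) (suc u′) v′)
    -- The factor `aq` always raises the exponent of q, so the induction hypothesis applies in every
    -- case.
    via-aqσ : ∀ y → aq ⊕ σ y ≡ x → coefficient y (P n) ≡ coefficient y (G (5 + i))
    via-aqσ (u′ , v′ , n′) refl = transport u′ v′ n′ (m≤n+m n′ _) (ih (s≤s (m≤n+m n′ _)) u′ v′)
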